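{- Let $n,k\in\mathbb{N}$. If a finite set $X\subseteq\mathbb{N}$ is $\omega^{n+6k}$-large and exp-sparse, then $X$ admits an $(\omega^n,\omega^k)$-grouping, i.e. for every colouring $P:[X]^2\to 2$ there exists an $(\omega^n,\omega^k)$-grouping for $P$.
   Context: Ordinals below $\omega^\omega$ are in Cantor normal form; $\omega^j\cdot m$ = sum of $m$ copies of $\omega^j$. For $m\in\mathbb{N}$: $0[m]=0$, $(\beta+1)[m]=\beta$, $(\beta+\omega^{n})[m]=\beta+\omega^{n-1}\cdot m$ for $n\ge1$. A finite $X=\{x_0<\dots<x_{\ell-1}\}\subseteq\mathbb{N}$ is $\alpha$-large if $\alpha[x_0]\cdots[x_{\ell-1}]=0$. A set $X$ with $\min X\ge3$ is exp-sparse if $x<y$ in $X$ implies $4^x<y$. For $\alpha,\beta<\omega^\omega$, $X\subseteq\mathbb{N}$ and $P:[X]^2\to2$, a finite sequence $\langle F_i\subseteq X:i<\ell\rangle$ of finite sets is an $(\alpha,\beta)$-grouping for $P$ if: (1) $\max F_i<\min F_j$ for all $i<j<\ell$; (2) each $F_i$ is $\alpha$-large; (3) $\{\max F_i:i<\ell\}$ is $\beta$-large; (4) for all $i<j<\ell$, all $x,x'\in F_i$ and $y,y'\in F_j$, $P(x,y)=P(x',y')$. -}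

module Defs where

open import Data.Fin as Fin using (Fin)
open import Data.List using (List; []; _∷_; _++_; foldl; replicate; tabulate)
open import Data.List.Extrema.Nat as Extrema using ()
open import Data.List.Membership.Propositional using () renaming (_∈_ to _∈ˡ_)
open import Data.List.NonEmpty as List⁺ using (List⁺; _∷_)
open import Data.List.Relation.Unary.All as All using (All; []; _∷_)
import Data.List.Relation.Unary.All.Properties as All
open import Data.List.Relation.Unary.Any using (here; there)
open import Data.List.Relation.Unary.AllPairs using (AllPairs; []; _∷_)
import Data.List.Relation.Unary.AllPairs.Properties as AllPairs
open import Data.Nat using (ℕ; zero; suc; _≤_; _<_; _^_)
open import Data.Nat.Properties using (≤-refl; ≤-trans; ≤-<-trans; <-≤-trans; n≤1+n)
open import Data.Product using (_×_)
open import Level using (0ℓ)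
open import Relation.Binary.PropositionalEquality using (_≡_; refl)
open import Relation.Unary using (Pred)

-- Cantor normal forms below ω^ω are stored least exponent first:
-- e₀ ∷ e₁ ∷ … ∷ eₖ ∷ [] with e₀ ≤ e₁ ≤ … ≤ eₖ is ω^eₖ + … + ω^e₁ + ω^e₀,
-- so that e ∷ β is β + ω^e.

CNF : List ℕ → Set
CNF = AllPairs _≤_

record Ord : Set where
  constructor ord
  field
    exponents : List ℕ
    .cnf      : CNF exponents

open Ord public

𝟘 : Ord
𝟘 = ord [] []

ω^_ : ℕ → Ord
ω^ n = ord (n ∷ []) ([] ∷ [])

step : List ℕ → ℕ → List ℕ
step []          m = []
step (zero  ∷ β) m = β
step (suc n ∷ β) m = replicate m n ++ β

step-cnf : ∀ α m → CNF α → CNF (step α m)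
step-cnf []          m c        = c
step-cnf (zero  ∷ β) m (_ ∷ c)  = c
step-cnf (suc n ∷ β) m (n<β ∷ c) = go m
  where
  n≤β : All (n ≤_) β
  n≤β = All.map (≤-trans (n≤1+n n)) n<β

  go : ∀ m → CNF (replicate m n ++ β)
  go zero    = c
  go (suc m) = All.++⁺ (All.replicate⁺ m ≤-refl) n≤β ∷ go m

infixl 8 _[_]

_[_] : Ord → ℕ → Ord
ord es c [ m ] = ord (step es m) (step-cnf es m c)

-- A finite subset of ℕ is given by its increasing enumeration.
record FinSet : Set where
  constructor finSet
  field
    elements   : List ℕ
    increasing : AllPairs _<_ elements

record FinSet⁺ : Set where
  constructor finSet⁺
  field
    elements⁺   : List⁺ ℕ
    increasing⁺ : AllPairs _<_ (List⁺.toList elements⁺)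

open FinSet public
open FinSet⁺ public

forget : FinSet⁺ → FinSet
forget F = finSet (List⁺.toList (elements⁺ F)) (increasing⁺ F)

infix 4 _∈_ _∈⁺_

_∈_ : ℕ → FinSet → Set
x ∈ X = x ∈ˡ elements X

_∈⁺_ : ℕ → FinSet⁺ → Set
x ∈⁺ F = x ∈ forget F

max : FinSet⁺ → ℕ
max (finSet⁺ (x ∷ xs) _) = Extrema.max x xs

min : FinSet⁺ → ℕ
min (finSet⁺ (x ∷ xs) _) = Extrema.min x xs

∈⇒≤max : ∀ F {x} → x ∈⁺ F → x ≤ max F
∈⇒≤max (finSet⁺ (x ∷ xs) _) (here refl) = Extrema.⊥≤max x xs
∈⇒≤max (finSet⁺ (x ∷ xs) _) (there p)   = All.lookup (Extrema.xs≤max x xs) p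

∈⇒min≤ : ∀ F {x} → x ∈⁺ F → min F ≤ x
∈⇒min≤ (finSet⁺ (x ∷ xs) _) (here refl) = Extrema.min≤⊤ x xs
∈⇒min≤ (finSet⁺ (x ∷ xs) _) (there p)   = All.lookup (Extrema.min≤xs x xs) p

min≤max : ∀ F → min F ≤ max F
min≤max F@(finSet⁺ (_ ∷ _) _) = ≤-trans (∈⇒min≤ F (here refl)) (∈⇒≤max F (here refl))

Large : Ord → FinSet → Set
Large α X = foldl _[_] α (elements X) ≡ 𝟘

ExpSparse : Pred ℕ 0ℓ → Set
ExpSparse X = (∀ {x} → X x → 3 ≤ x) × (∀ {x y} → X x → X y → x < y → 4 ^ x < y)

-- [X]², a two-element subset being listed in increasing order. The proof fields
-- are irrelevant, so a colouring depends on the two elements only.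
record [_]² (X : Pred ℕ 0ℓ) : Set where
  constructor pair
  field
    lower upper  : ℕ
    .lower∈      : X lower
    .upper∈      : X upper
    .lower<upper : lower < upper

Colouring : Pred ℕ 0ℓ → Set
Colouring X = [ X ]² → Fin 2

Separated : ∀ {ℓ} → (Fin ℓ → FinSet⁺) → Set
Separated F = ∀ {i j} → i Fin.< j → max (F i) < min (F j)

separated⇒< : ∀ {ℓ} (F : Fin ℓ → FinSet⁺) → Separated F →
              ∀ {i j x y} → i Fin.< j → x ∈⁺ F i → y ∈⁺ F j → x < y
separated⇒< F sep {i} {j} i<j x∈ y∈ =
  ≤-<-trans (∈⇒≤max (F i) x∈) (<-≤-trans (sep i<j) (∈⇒min≤ (F j) y∈))

maxima : ∀ {ℓ} (F : Fin ℓ → FinSet⁺) → Separated F → FinSet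
maxima F sep = finSet (tabulate (λ i → max (F i)))
  (AllPairs.tabulate⁺-< (λ {i} {j} i<j → <-≤-trans (sep i<j) (min≤max (F j))))

-- The sets Fᵢ are nonempty because the definition refers to their maxima and
-- minima; this is automatic when α ≠ 0, as the empty set is only 0-large.
record Grouping (α β : Ord) (X : Pred ℕ 0ℓ) (P : Colouring X) : Set where
  field
    ℓ            : ℕ
    F            : Fin ℓ → FinSet⁺
    F⊆X          : ∀ {i x} → x ∈⁺ F i → X x
    separated    : Separated F
    F-large      : ∀ i → Large α (forget (F i))
    maxima-large : Large β (maxima F separated)
    homogeneous  : ∀ {i j x x′ y y′} (i<j : i Fin.< j)
                   (x∈ : x ∈⁺ F i) (x′∈ : x′ ∈⁺ F i) (y∈ : y ∈⁺ F j) (y′∈ : y′ ∈⁺ F j) →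
                   P (pair x  y  (F⊆X x∈)  (F⊆X y∈)  (separated⇒< F separated i<j x∈  y∈)) ≡
                   P (pair x′ y′ (F⊆X x′∈) (F⊆X y′∈) (separated⇒< F separated i<j x′∈ y′∈))

AdmitsGrouping : Ord → Ord → Pred ℕ 0ℓ → Set
AdmitsGrouping α β X = (P : Colouring X) → Grouping α β X P

{-# OPTIONS --safe #-}

-- Pigeonhole: if X is ω^(n+1)-large, exp-sparse and coloured with fewer than min X colours, then
-- some colour class is ω^n-large.
--
-- Case β = ω: inside an ω^(n+4)-large X take an ω^(n+1)-large set U with maximum m, followed by
-- more than 4^m sets C_j that are ω^(n+2)-large. By the pigeonhole principle shrink each C_j so
-- that P(x,·) is constant on it for every earlier x (at most 2^(max of the earlier elements)
-- colours). Halving the family once for each x ∈ U leaves m of the C_j on which P(x,·) takes the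
-- same value for all of them; then shrink U (2 colours) and these m sets (2^m colours) to make
-- the colour depend on the pair of sets only.
--
-- Passage from k to k+1: the groupings of the members of an ω-grouping concatenate to a grouping,
-- since the colour between different members is already constant.
module Submission where

open import Algebra.Properties.CommutativeMonoid.Sum using ()
open import Data.Empty using (⊥-elim)
open import Data.Fin as Fin using (Fin; zero; suc; funToFin; finToFun)
import Data.Fin.Properties as Fin
open import Data.List
  using (List; []; _∷_; _++_; concat; filter; foldl; length; lookup; map; replicate; tabulate; take)
open import Data.List.Extrema.Nat as Extrema using ()
open import Data.List.Membership.DecPropositional using (_∈?_)
open import Data.List.Membership.Propositional using () renaming (_∈_ to _∈ˡ_)
open import Data.List.Membership.Propositional.Properties using (∈-lookup; ∈-++⁺ˡ; ∈-++⁺ʳ)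
open import Data.List.NonEmpty using (_∷_)
open import Data.List.Properties
  using (++-assoc; concat-++; filter-++; filter-accept; filter-reject; length-++; length-filter;
    length-replicate; length-take; map-++; ++-identityʳ; map-tabulate; tabulate-cong;
    tabulate-lookup)
open import Data.List.Relation.Binary.Sublist.Heterogeneous using (Sublist; []; _∷_; _∷ʳ_; minimum)
open import Data.List.Relation.Binary.Sublist.Propositional using (_⊆_; ⊆-refl; ⊆-reflexive; ⊆-trans; from∈)
open import Data.List.Relation.Binary.Sublist.Propositional.Properties
  using (All-resp-⊆; Any-resp-⊆; concat⁺; filter-⊆; take-⊆; ++⁺; ++⁺ˡ; ++⁺ʳ)
open import Data.List.Relation.Unary.All as All using (All; []; _∷_)
import Data.List.Relation.Unary.All.Properties as All
open import Data.List.Relation.Unary.AllPairs as AllPairs using (AllPairs; []; _∷_)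
import Data.List.Relation.Unary.AllPairs.Properties as AllPairs
open import Data.List.Relation.Unary.Any as Any using (Any; here; there)
open import Data.List.Relation.Unary.Any.Properties using (lookup-index)
open import Data.Nat using (ℕ; zero; suc; _+_; _*_; _∸_; _^_; _≤_; _<_; z≤n; s≤s; s≤s⁻¹; _≟_; _<?_)
open import Data.Nat.Properties
open import Data.Product as Product using (∃; _×_; _,_)
open import Data.Sum using (inj₁; inj₂)
open import Data.Vec.Functional using (updateAt)
open import Data.Vec.Functional.Properties using (updateAt-updates; updateAt-minimal)
open import Function using (_∘_)
open import Relation.Binary.PropositionalEquality
open import Relation.Nullary using (yes; no)
open import Defs

open Algebra.Properties.CommutativeMonoid.Sum +-0-commutativeMonoid using (sum; sum-cong-≗)

-- Largeness on bare exponent lists and its monotonicity.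

data IsLarge : List ℕ → List ℕ → Set where
  done : IsLarge [] []
  next : ∀ {α x X} → IsLarge (step α x) X → IsLarge α (x ∷ X)

Increasing : List ℕ → Set
Increasing = AllPairs _<_

[]-large : ∀ X → IsLarge [] X
[]-large []      = done
[]-large (x ∷ X) = next ([]-large X)

-- Mutual induction along X with the three lemmas below. An element u of X exceeds x, so stepping at
-- u leaves at least as many copies as stepping at x, and the surplus is dropped.
step-large : ∀ {x α} X → Increasing (x ∷ X) → IsLarge α X → IsLarge (step α x) X
drop₁      : ∀ {e β} X → Increasing X → IsLarge (e ∷ β) X → IsLarge β X
drop*      : ∀ γ {β} X → Increasing X → IsLarge (γ ++ β) X → IsLarge β X
drop-+     : ∀ d {b e β} X → Increasing X →
             IsLarge (replicate (d + b) e ++ β) X → IsLarge (replicate b e ++ β) X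

step-large []      _ done = done
step-large {α = []} (u ∷ X) _ l = l
step-large {α = zero  ∷ β} (u ∷ X) (_ ∷ inc) (next l) = next (step-large X inc l)
step-large {x} {suc e ∷ β} (u ∷ X) ((x<u ∷ _) ∷ inc) (next l) =
  next (step-large X inc (drop-+ (u ∸ x) X (AllPairs.tail inc)
    (subst (λ n → IsLarge (replicate n e ++ β) X) (sym (m∸n+n≡m (<⇒≤ x<u))) l)))

drop₁ {zero}  (u ∷ X) inc (next l) = next (step-large X inc l)
drop₁ {suc e} (u ∷ X) inc (next l) =
  next (step-large X inc (drop* (replicate u e) X (AllPairs.tail inc) l))

drop* []      X inc l = l
drop* (g ∷ γ) X inc l = drop* γ X inc (drop₁ X inc l)

drop-+ zero    X inc l = l
drop-+ (suc d) X inc l = drop-+ d X inc (drop₁ X inc l)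

drop-step : ∀ {e β x} X → Increasing X → IsLarge (e ∷ β) (x ∷ X) → IsLarge β X
drop-step {zero}      X inc (next l) = l
drop-step {suc e} {x = x} X inc (next l) = drop* (replicate x e) X inc l

prepend : ∀ {x α X} → Increasing (x ∷ X) → IsLarge α X → IsLarge α (x ∷ X)
prepend inc l = next (step-large _ inc l)

replicate-mono : ∀ {a b e β X} → Increasing X → b ≤ a →
                 IsLarge (replicate a e ++ β) X → IsLarge (replicate b e ++ β) X
replicate-mono {a} {b} {e} {β} {X} inc b≤a l = drop-+ (a ∸ b) X inc
  (subst (λ n → IsLarge (replicate n e ++ β) X) (sym (m∸n+n≡m b≤a)) l)

step-++ : ∀ e α β m → step ((e ∷ α) ++ β) m ≡ step (e ∷ α) m ++ β
step-++ zero    α β m = refl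
step-++ (suc e) α β m = sym (++-assoc (replicate m e) α β)

-- Least exponents come first, so α is used up before β is touched; the cut is where α reaches zero.
split : ∀ α {β} X → IsLarge (α ++ β) X →
        ∃ λ U → ∃ λ V → X ≡ U ++ V × IsLarge α U × IsLarge β V
split []      X l = [] , X , refl , done , l
split (e ∷ α) {β} (x ∷ X) (next l)
  with U , V , refl , lU , lV ← split (step (e ∷ α) x) X (subst (λ γ → IsLarge γ X) (step-++ e α β x) l)
  = x ∷ U , V , refl , next lU , lV

join : ∀ {α β} U {V} → Increasing (U ++ V) → IsLarge α U → IsLarge β V → IsLarge (α ++ β) (U ++ V)
join []      inc done lV = lV
-- α may reach zero before U ends; the surplus elements of U are put in front of the rest, which
-- preserves largeness.
join {[]}    (x ∷ U) inc (next lU) lV = prepend inc (join U (AllPairs.tail inc) lU lV)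
join {e ∷ α} {β} (x ∷ U) inc (next lU) lV =
  next (subst (λ γ → IsLarge γ _) (sym (step-++ e α β x)) (join U (AllPairs.tail inc) lU lV))

-- Comparing ordinals through their coefficients.

-- expand N σ δ is the ordinal δ + Σ_{e<N} ω^e · σ e. Below ω^N the natural sum of ordinals
-- is the pointwise sum of coefficient functions σ.
expand : ℕ → (ℕ → ℕ) → List ℕ → List ℕ
expand zero    σ δ = δ
expand (suc e) σ δ = expand e σ (replicate (σ e) e ++ δ)

drop-expand : ∀ N {σ δ X} → Increasing X → IsLarge (expand N σ δ) X → IsLarge δ X
drop-expand zero        inc l = l
drop-expand (suc N) {σ} inc l = drop* (replicate (σ N) N) _ inc (drop-expand N inc l)

-- Stepping ω^(e+1) at z leaves z copies of ω^e, hence `σ e` copies and one more. The extra copy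
-- goes to the next element, itself larger than z, to produce the coefficients below e.
expand-descend : ∀ e {σ δ z X} → Increasing (z ∷ X) → (∀ {j} → j < e → σ j < z) →
                 IsLarge (e ∷ δ) (z ∷ X) → IsLarge (expand e σ δ) X
expand-descend zero    inc σ<z (next l) = l
expand-descend (suc e) (z<X ∷ inc) σ<z (next l)
  with replicate-mono inc (σ<z ≤-refl) l
expand-descend (suc e) {X = x ∷ X} ((z<x ∷ _) ∷ inc) σ<z (next _) | l =
  prepend inc (expand-descend e inc (λ j<e → <-trans (σ<z (m<n⇒m<1+n j<e)) z<x) l)

-- If σ′ < σ lexicographically, first differing at e, and the coefficients of σ′ below e are less
-- than z, then σ′ is still at most the ordinal obtained by stepping σ at z.
exchange : ∀ N {e σ σ′ δ z X} → e < N → (∀ {j} → e < j → σ′ j ≡ σ j) → σ′ e < σ e →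
           (∀ {j} → j < e → σ′ j < z) → Increasing (z ∷ X) →
           IsLarge (expand N σ δ) (z ∷ X) → IsLarge (expand N σ′ δ) X
exchange (suc N) e<1+N above at below inc l with m≤n⇒m<n∨m≡n (s≤s⁻¹ e<1+N)
... | inj₁ e<N rewrite above e<N = exchange N e<N above at below inc l
... | inj₂ refl = expand-descend N inc below (replicate-mono inc at (drop-expand N inc l))

expand-[] : ∀ N {e σ δ} → e < N → IsLarge (expand N σ δ) [] → σ e ≡ 0
expand-[] (suc N) {e} {σ} e<1+N l with m≤n⇒m<n∨m≡n (s≤s⁻¹ e<1+N)
... | inj₁ e<N = expand-[] N e<N l
... | inj₂ refl with σ N | drop-expand N [] l
...   | zero  | _  = refl

-- Coefficients, their growth under stepping, and finite sums.

count : ℕ → List ℕ → ℕ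
count j α = length (filter (j ≟_) α)

count-++ : ∀ j α β → count j (α ++ β) ≡ count j α + count j β
count-++ j α β rewrite filter-++ (j ≟_) α β = length-++ (filter (j ≟_) α)

count-∷-≡ : ∀ e α → count e (e ∷ α) ≡ suc (count e α)
count-∷-≡ e α = cong length (filter-accept (e ≟_) refl)

count-∷-≢ : ∀ {j e} α → j ≢ e → count j (e ∷ α) ≡ count j α
count-∷-≢ {j} α j≢e = cong length (filter-reject (j ≟_) j≢e)

count-replicate-≢ : ∀ {j e} m → j ≢ e → count j (replicate m e) ≡ 0
count-replicate-≢ zero    j≢e = refl
count-replicate-≢ {j} {e} (suc m) j≢e = trans (count-∷-≢ (replicate m e) j≢e) (count-replicate-≢ m j≢e)

count-step-≥ : ∀ {j e} β m → e ≤ j → count j (step (e ∷ β) m) ≡ count j β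
count-step-≥ {j} {zero}  β m e≤j = refl
count-step-≥ {j} {suc e} β m e<j = trans (count-++ j (replicate m e) β)
  (cong (_+ count j β) (count-replicate-≢ m (λ { refl → <-irrefl refl e<j })))

count-≤-∷ : ∀ j e β → count j β ≤ count j (e ∷ β)
count-≤-∷ j e β with j ≟ e
... | yes refl = ≤-trans (n≤1+n _) (≤-reflexive (sym (count-∷-≡ e β)))
... | no j≢e   = ≤-reflexive (sym (count-∷-≢ β j≢e))

count-step-≤ : ∀ j e β m → count j (step (e ∷ β) m) ≤ m + count j (e ∷ β)
count-step-≤ j zero    β m = ≤-trans (count-≤-∷ j zero β) (m≤n+m _ m)
count-step-≤ j (suc e) β m = begin
  count j (replicate m e ++ β)              ≡⟨ count-++ j (replicate m e) β ⟩
  count j (replicate m e) + count j β       ≤⟨ +-mono-≤ (length-filter (j ≟_) (replicate m e)) (count-≤-∷ j (suc e) β) ⟩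
  length (replicate m e) + count j (suc e ∷ β) ≡⟨ cong (_+ count j (suc e ∷ β)) (length-replicate m) ⟩
  m + count j (suc e ∷ β)                   ∎
  where open ≤-Reasoning

step-< : ∀ {N} α m → All (_< N) α → All (_< N) (step α m)
step-< []          m _             = []
step-< (zero  ∷ β) m (_ ∷ β<N)     = β<N
step-< (suc e ∷ β) m (1+e<N ∷ β<N) = All.++⁺ (All.replicate⁺ m (<-trans ≤-refl 1+e<N)) β<N

sum-≤ : ∀ {c b} (f : Fin c → ℕ) → (∀ i → f i ≤ b) → sum f ≤ c * b
sum-≤ {zero}  f f≤b = z≤n
sum-≤ {suc c} f f≤b = +-mono-≤ (f≤b zero) (sum-≤ (f ∘ suc) (f≤b ∘ suc))

sum-mono-≤ : ∀ {c} (f g : Fin c → ℕ) → (∀ i → f i ≤ g i) → sum f ≤ sum g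
sum-mono-≤ {zero}  f g f≤g = z≤n
sum-mono-≤ {suc c} f g f≤g = +-mono-≤ (f≤g zero) (sum-mono-≤ (f ∘ suc) (g ∘ suc) (f≤g ∘ suc))

sum-mono-< : ∀ {c} (f g : Fin c → ℕ) i → (∀ j → f j ≤ g j) → f i < g i → sum f < sum g
sum-mono-< f g zero    f≤g f<g = +-mono-<-≤ f<g (sum-mono-≤ (f ∘ suc) (g ∘ suc) (f≤g ∘ suc))
sum-mono-< f g (suc i) f≤g f<g = +-mono-≤-< (f≤g zero) (sum-mono-< (f ∘ suc) (g ∘ suc) i (f≤g ∘ suc) f<g)

term≤sum : ∀ {c} (f : Fin c → ℕ) i → f i ≤ sum f
term≤sum f zero    = m≤m+n _ _
term≤sum f (suc i) = ≤-trans (term≤sum (f ∘ suc) i) (m≤n+m _ _)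

-- Powers of two and four, and sparse sets.

n<2^n : ∀ n → n < 2 ^ n
n<2^n zero    = ≤-refl
n<2^n (suc n) = begin-strict
  1 + n               <⟨ +-mono-≤-< (m^n>0 2 n) (n<2^n n) ⟩
  2 ^ n + 2 ^ n       ≡⟨ cong (2 ^ n +_) (+-identityʳ (2 ^ n)) ⟨
  2 ^ suc n           ∎
  where open ≤-Reasoning

2n≤2^n : ∀ n → 1 ≤ n → n + n ≤ 2 ^ n
2n≤2^n (suc n) _ = ≤-trans (+-mono-≤ (n<2^n n) (n<2^n n))
  (≤-reflexive (cong (2 ^ n +_) (sym (+-identityʳ (2 ^ n)))))

2^n*2^n≡4^n : ∀ n → 2 ^ n * 2 ^ n ≡ 4 ^ n
2^n*2^n≡4^n n = begin
  2 ^ n * 2 ^ n    ≡⟨ ^-distribˡ-+-* 2 n n ⟨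
  2 ^ (n + n)      ≡⟨ cong (λ m → 2 ^ (n + m)) (+-identityʳ n) ⟨
  2 ^ (2 * n)      ≡⟨ ^-*-assoc 2 2 n ⟨
  4 ^ n            ∎
  where open ≡-Reasoning

n<4^n : ∀ n → n < 4 ^ n
n<4^n n = <-≤-trans (n<2^n n) (^-monoˡ-≤ n (s≤s (s≤s z≤n)))

record Sparse (X : List ℕ) : Set where
  constructor sparse
  field
    ≥3  : All (3 ≤_) X
    gap : AllPairs (λ x y → 4 ^ x < y) X

  increasing′ : Increasing X
  increasing′ = AllPairs.map (<-trans (n<4^n _)) gap

open Sparse

lower : ∀ {e β X} → Sparse X → IsLarge (suc e ∷ β) X → IsLarge (e ∷ β) X
lower sp@(sparse (3≤x ∷ _) _) (next l) =
  prepend inc (replicate-mono (AllPairs.tail inc) (≤-trans (s≤s z≤n) 3≤x) l)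
  where inc = increasing′ sp

-- The pigeonhole principle for large sets.

colourClass : ∀ {c} → (ℕ → Fin c) → Fin c → List ℕ → List ℕ
colourClass f i = filter (λ x → f x Fin.≟ i)

-- The coefficient of ω^j in the natural sum of the ordinals `α i`.
totalCount : ∀ {c} → (Fin c → List ℕ) → ℕ → ℕ
totalCount α j = sum (λ i → count j (α i))

-- The ordinals α i are stepped along their colour classes while their natural sum, which
-- decreases at every step, is compared with the ordinal left of the whole set. The natural sum
-- lags one element behind, so that the gap from y to the next element z absorbs the growth of
-- its coefficients.
pigeonhole-state : ∀ {c} N (f : ℕ → Fin c) (α : Fin c → List ℕ) y W → Sparse (y ∷ W) → c < y →
                   (∀ i → All (_< N) (α i)) → (∀ i j → count j (α i) ≤ y) →
                   IsLarge (expand N (totalCount α) []) W →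
                   ∃ λ i → IsLarge (α i) (colourClass f i (y ∷ W))
pigeonhole-state {c} N f α y W sp c<y α<N α≤y l with α (f y) in eq | α<N (f y)
-- The ordinal for the colour of y is already used up, and every list is 0-large.
... | []    | _ = f y , subst (λ γ → IsLarge γ (colourClass f (f y) (y ∷ W))) (sym eq) ([]-large _)
-- No element is left, so the natural sum is zero, yet the ordinal for the colour of y still
-- contains ω^e.
pigeonhole-state {c} N f α y [] sp c<y α<N α≤y l | e ∷ β | e<N ∷ _ = ⊥-elim (<-irrefl refl (begin-strict
  0                       <⟨ s≤s z≤n ⟩
  suc (count e β)         ≡⟨ count-∷-≡ e β ⟨
  count e (e ∷ β)         ≡⟨ cong (count e) eq ⟨
  count e (α (f y))       ≤⟨ term≤sum (λ i → count e (α i)) (f y) ⟩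
  totalCount α e          ≡⟨ expand-[] N e<N l ⟩
  0                       ∎))
  where open ≤-Reasoning
pigeonhole-state {c} N f α y (z ∷ W) sp@(sparse (3≤y ∷ ≥3) ((4^y<z ∷ _) ∷ gap)) c<y α<N α≤y l | e ∷ β | e<N ∷ _ =
  Product.map₂ (unstep _)
    (pigeonhole-state N f α′ z W (sparse ≥3 gap) (<-trans c<y y<z) α′<N α′≤z
      -- Stepping at y leaves the coefficients of the natural sum above e unchanged, lowers the one
      -- at e, and keeps those below e under z.
      (exchange N e<N above at below (increasing′ (sparse ≥3 gap)) l))
  where
  α′ : Fin c → List ℕ
  α′ = updateAt α (f y) (λ γ → step γ y)

  α′-at : α′ (f y) ≡ step (e ∷ β) y
  α′-at = trans (updateAt-updates (f y) α) (cong (λ γ → step γ y) eq)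

  y<z : y < z
  y<z = <-trans (n<4^n y) 4^y<z

  α′-cases : ∀ {ℓ} (Q : Fin c → List ℕ → Set ℓ) → Q (f y) (step (e ∷ β) y) → (∀ i → i ≢ f y → Q i (α i)) →
             ∀ i → Q i (α′ i)
  α′-cases Q at other i with i Fin.≟ f y
  ... | yes refl = subst (Q i) (sym α′-at) at
  ... | no i≢    = subst (Q i) (sym (updateAt-minimal i (f y) α i≢)) (other i i≢)

  α′<N : ∀ i → All (_< N) (α′ i)
  α′<N = α′-cases (λ _ → All (_< N)) (step-< (e ∷ β) y (subst (All (_< N)) eq (α<N (f y)))) (λ i _ → α<N i)

  α′≤2y : ∀ j i → count j (α′ i) ≤ y + y
  α′≤2y j = α′-cases (λ _ γ → count j γ ≤ y + y)
    (≤-trans (count-step-≤ j e β y) (+-monoʳ-≤ y (subst (λ γ → count j γ ≤ y) eq (α≤y (f y) j))))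
    (λ i _ → ≤-trans (α≤y i j) (m≤m+n y y))

  2y≤2^y : y + y ≤ 2 ^ y
  2y≤2^y = 2n≤2^n y (≤-trans (s≤s z≤n) 3≤y)

  α′≤z : ∀ i j → count j (α′ i) ≤ z
  α′≤z i j = ≤-trans (α′≤2y j i) (≤-trans 2y≤2^y (<⇒≤ (≤-<-trans (^-monoˡ-≤ y (s≤s (s≤s z≤n))) 4^y<z)))

  below : ∀ {j} → j < e → totalCount α′ j < z
  below {j} _ = begin-strict
    totalCount α′ j  ≤⟨ sum-≤ _ (α′≤2y j) ⟩
    -- Each of the c < y colours contributes a coefficient of at most 2y. Both factors are bounded
    -- by 2^y, which is why sparsity has base 4.
    c * (y + y)      ≤⟨ *-mono-≤ (<⇒≤ (<-trans c<y (n<2^n y))) 2y≤2^y ⟩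
    2 ^ y * 2 ^ y    ≡⟨ 2^n*2^n≡4^n y ⟩
    4 ^ y            <⟨ 4^y<z ⟩
    z                ∎
    where open ≤-Reasoning

  above : ∀ {j} → e < j → totalCount α′ j ≡ totalCount α j
  above {j} e<j = sum-cong-≗ (α′-cases (λ i γ → count j γ ≡ count j (α i))
    (trans (count-step-≥ β y (<⇒≤ e<j))
      (trans (sym (count-∷-≢ β (λ { refl → <-irrefl refl e<j }))) (cong (count j) (sym eq))))
    (λ _ _ → refl))

  at-f : count e (step (e ∷ β) y) < count e (α (f y))
  at-f = ≤-reflexive (trans (cong suc (count-step-≥ β y ≤-refl))
    (trans (sym (count-∷-≡ e β)) (cong (count e) (sym eq))))

  at : totalCount α′ e < totalCount α e
  at = sum-mono-< _ _ (f y)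
    (α′-cases (λ i γ → count e γ ≤ count e (α i)) (<⇒≤ at-f) (λ _ _ → ≤-refl))
    (subst (λ γ → count e γ < count e (α (f y))) (sym α′-at) at-f)

  unstep : ∀ i → IsLarge (α′ i) (colourClass f i (z ∷ W)) → IsLarge (α i) (colourClass f i (y ∷ z ∷ W))
  unstep i l with f y Fin.≟ i
  ... | yes refl = next (subst (λ γ → IsLarge γ (colourClass f i (z ∷ W))) (updateAt-updates (f y) α) l)
  ... | no fy≢i  = subst (λ γ → IsLarge γ (colourClass f i (z ∷ W))) (updateAt-minimal i (f y) α (fy≢i ∘ sym)) l

-- The state starts with ω^n for every colour. Their natural sum ω^n·c is covered because stepping
-- ω^(n+1) at the first element x leaves ω^n·x and c < x.
pigeonhole : ∀ {c} n (f : ℕ → Fin c) X → Sparse X → All (c <_) X → IsLarge (suc n ∷ []) X →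
             ∃ λ i → IsLarge (n ∷ []) (colourClass f i X)
pigeonhole {c} n f (x ∷ X) sp (c<x ∷ _) l =
  pigeonhole-state (suc n) f (λ _ → n ∷ []) x X sp c<x (λ _ → ≤-refl ∷ []) (λ _ j → ≤-trans (count≤1 j) (≤-trans (s≤s z≤n) c<x))
    (expand-descend (suc n) (increasing′ sp)
      (λ {j} _ → ≤-<-trans (sum-≤ {c} _ (λ _ → count≤1 j)) (≤-<-trans (≤-reflexive (*-identityʳ c)) c<x)) l)
  where
  count≤1 : ∀ j → count j (n ∷ []) ≤ 1
  count≤1 j = length-filter (j ≟_) (n ∷ [])

-- Sublists and pairwise relations.

∈⇒⊆concat : ∀ {A : Set} {B : List A} {Bs} → B ∈ˡ Bs → B ⊆ concat Bs
∈⇒⊆concat {Bs = _ ∷ Bs} (here refl) = ++⁺ʳ (concat Bs) ⊆-refl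
∈⇒⊆concat {Bs = B ∷ _}  (there B∈)  = ++⁺ˡ B (∈⇒⊆concat B∈)

AllPairs-resp-⊆ : ∀ {A : Set} {R : A → A → Set} {xs ys} → xs ⊆ ys → AllPairs R ys → AllPairs R xs
AllPairs-resp-⊆ []         []       = []
AllPairs-resp-⊆ (_ ∷ʳ s)   (_ ∷ ps) = AllPairs-resp-⊆ s ps
AllPairs-resp-⊆ (refl ∷ s) (p ∷ ps) = All-resp-⊆ s p ∷ AllPairs-resp-⊆ s ps

AllPairs-++⁻ : ∀ {A : Set} {R : A → A → Set} xs {ys x y} → AllPairs R (xs ++ ys) →
               x ∈ˡ xs → y ∈ˡ ys → R x y
AllPairs-++⁻ (x ∷ xs) (p ∷ _)  (here refl) y∈ = All.lookup p (∈-++⁺ʳ xs y∈)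
AllPairs-++⁻ (x ∷ xs) (_ ∷ ps) (there x∈)  y∈ = AllPairs-++⁻ xs ps x∈ y∈

AllPairs-concat⁻ : ∀ {A : Set} {R : A → A → Set} xss → AllPairs R (concat xss) →
                   AllPairs (λ xs ys → ∀ {x y} → x ∈ˡ xs → y ∈ˡ ys → R x y) xss
AllPairs-concat⁻ []         _  = []
AllPairs-concat⁻ (xs ∷ xss) ps =
  All.tabulate (λ ys∈ x∈ y∈ → AllPairs-++⁻ xs ps x∈ (Any-resp-⊆ (∈⇒⊆concat ys∈) y∈))
  ∷ AllPairs-concat⁻ xss (AllPairs-resp-⊆ (++⁺ˡ xs ⊆-refl) ps)

AllPairs-lookup : ∀ {A : Set} {R : A → A → Set} {xs} → AllPairs R xs →
                  ∀ {i j} → i Fin.< j → R (lookup xs i) (lookup xs j)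
AllPairs-lookup {xs = _ ∷ xs} (p ∷ ps) {zero}  {suc j} _         = All.lookup p (∈-lookup j)
AllPairs-lookup               (p ∷ ps) {suc i} {suc j} (s≤s i<j) = AllPairs-lookup ps i<j

-- Used with S as inclusion, to carry a property from a family of blocks to a family of shrunken
-- blocks.
All-Sublist : ∀ {A : Set} {S : A → A → Set} {P Q : A → Set} → (∀ {a b} → S a b → Q b → P a) →
              ∀ {as bs} → Sublist S as bs → All Q bs → All P as
All-Sublist f []       []       = []
All-Sublist f (_ ∷ʳ s) (_ ∷ qs) = All-Sublist f s qs
All-Sublist f (r ∷ s)  (q ∷ qs) = f r q ∷ All-Sublist f s qs

Sublist-trans-⊆ : ∀ {A : Set} {S : A → A → Set} {as bs cs} → as ⊆ bs → Sublist S bs cs → Sublist S as cs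
Sublist-trans-⊆ s          (c ∷ʳ t) = c ∷ʳ Sublist-trans-⊆ s t
Sublist-trans-⊆ []         []       = []
Sublist-trans-⊆ (_ ∷ʳ s)   (_ ∷ t)  = _ ∷ʳ Sublist-trans-⊆ s t
Sublist-trans-⊆ (refl ∷ s) (r ∷ t)  = r ∷ Sublist-trans-⊆ s t

Sparse-resp-⊆ : ∀ {X Y} → X ⊆ Y → Sparse Y → Sparse X
Sparse-resp-⊆ s (sparse ≥3 gap) = sparse (All-resp-⊆ s ≥3) (AllPairs-resp-⊆ s gap)

-- Monochromatic subsets.

monochromatic : ∀ {c} n (f : ℕ → Fin c) X → Sparse X → All (c <_) X → IsLarge (suc n ∷ []) X →
                ∃ λ Y → Y ⊆ X × IsLarge (n ∷ []) Y × (∀ {x y} → x ∈ˡ Y → y ∈ˡ Y → f x ≡ f y)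
monochromatic n f X sp c<X l with i , lᵢ ← pigeonhole n f X sp c<X l =
  colourClass f i X , filter-⊆ _ X , lᵢ ,
  λ x∈ y∈ → trans (All.lookup all x∈) (sym (All.lookup all y∈))
  where all = All.all-filter (λ x → f x Fin.≟ i) X

-- The m two-colourings are coded as one colouring by `Fin (2 ^ m)`, so a single exponent pays for
-- all of them.
monochromatic* : ∀ {m} n (g : Fin m → ℕ → Fin 2) X → Sparse X → All (2 ^ m <_) X → IsLarge (suc n ∷ []) X →
                 ∃ λ Y → Y ⊆ X × IsLarge (n ∷ []) Y × (∀ {x y} → x ∈ˡ Y → y ∈ˡ Y → ∀ j → g j x ≡ g j y)
monochromatic* {m} n g X sp 2^m<X l with Y , Y⊆X , lY , same ← monochromatic n (λ x → funToFin (λ j → g j x)) X sp 2^m<X l =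
  Y , Y⊆X , lY , λ {x} {y} x∈ y∈ j → begin
    g j x                    ≡⟨ Fin.finToFun-funToFin (λ j → g j x) j ⟨
    finToFun (funToFin (λ j → g j x)) j ≡⟨ cong (λ c → finToFun c j) (same x∈ y∈) ⟩
    finToFun (funToFin (λ j → g j y)) j ≡⟨ Fin.finToFun-funToFin (λ j → g j y) j ⟩
    g j y                    ∎
  where open ≡-Reasoning

-- Sizes and maxima in sparse sets.

length-≤-element : ∀ {a x} L → a ≤ x → Increasing (x ∷ L) → ∃ λ w → w ∈ˡ x ∷ L × a + length L ≤ w
length-≤-element {a} {x} []       a≤x _ = x , here refl , ≤-trans (≤-reflexive (+-identityʳ a)) a≤x
length-≤-element {a} {x} (x′ ∷ L) a≤x ((x<x′ ∷ _) ∷ inc)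
  with w , w∈ , le ← length-≤-element {suc a} L (≤-<-trans a≤x x<x′) inc
  = w , there w∈ , ≤-trans (≤-reflexive (+-suc a (length L))) le

-- A nonempty U increases strictly from at least 1, so it has an element w no smaller than its
-- length, and 2^w ≤ 4^w < v for v in V. This bounds the number of colour vectors over U.
2^length< : ∀ U {V} → Sparse (U ++ V) → All (2 ^ length U <_) V
2^length< []      sp = All.map (<-≤-trans (s≤s (s≤s z≤n))) (≥3 sp)
2^length< (x ∷ U) {V} sp@(sparse (3≤x ∷ _) _)
  with w , w∈ , le ← length-≤-element {1} U (≤-trans (s≤s z≤n) 3≤x)
                       (AllPairs-resp-⊆ (++⁺ʳ V ⊆-refl) (increasing′ sp))
  = All.tabulate λ {v} v∈ → begin-strict
    2 ^ suc (length U) ≤⟨ ^-monoʳ-≤ 2 le ⟩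
    2 ^ w              ≤⟨ ^-monoˡ-≤ w (s≤s (s≤s z≤n)) ⟩
    4 ^ w              <⟨ AllPairs-++⁻ (x ∷ U) (gap sp) w∈ v∈ ⟩
    v                  ∎
  where open ≤-Reasoning

headOr : ∀ {A : Set} → A → List A → A
headOr d []      = d
headOr d (x ∷ _) = x

headOr∈ : ∀ {A : Set} {d x : A} {xs} → x ∈ˡ xs → headOr d xs ∈ˡ xs
headOr∈ (here _)  = here refl
headOr∈ (there _) = here refl

-- The value 0 at [] is never used: all blocks are nonempty.
top : List ℕ → ℕ
top []       = 0
top (x ∷ xs) = Extrema.max x xs

≤top : ∀ {x} X → x ∈ˡ X → x ≤ top X
≤top (x ∷ X) (here refl) = Extrema.⊥≤max x X
≤top (x ∷ X) (there x∈)  = All.lookup (Extrema.xs≤max x X) x∈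

top∈ : ∀ {n X} → IsLarge (n ∷ []) X → top X ∈ˡ X
top∈ {X = x ∷ X} _ with Extrema.argmax-sel (λ y → y) x X
... | inj₁ eq  = here eq
... | inj₂ x∈  = there x∈

length≤top : ∀ {n U} → Sparse U → IsLarge (n ∷ []) U → length U ≤ top U
length≤top {U = x ∷ U} sp@(sparse (3≤x ∷ _) _) _
  with w , w∈ , le ← length-≤-element {1} U (≤-trans (s≤s z≤n) 3≤x) (increasing′ sp)
  = ≤-trans le (≤top (x ∷ U) w∈)

-- Guarantees that z blocks survive one halving per element of U with `top U` of them left. Both
-- factors are at most 2^(top U), and 4^(top U) < z.
2^length*top≤ : ∀ {n} U {z V} → Sparse (U ++ z ∷ V) → IsLarge (n ∷ []) U → 2 ^ length U * top U ≤ z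
2^length*top≤ U {z} {V} sp lU = begin
  2 ^ length U * top U   ≤⟨ *-mono-≤ (^-monoʳ-≤ 2 (length≤top (Sparse-resp-⊆ (++⁺ʳ (z ∷ V) ⊆-refl) sp) lU)) (<⇒≤ (n<2^n (top U))) ⟩
  2 ^ top U * 2 ^ top U  ≡⟨ 2^n*2^n≡4^n (top U) ⟩
  4 ^ top U              <⟨ AllPairs-++⁻ U (gap sp) (top∈ lU) (here refl) ⟩
  z                      ∎
  where open ≤-Reasoning

-- Lets the maxima inherit the increasing order of the elements.
tops-⊆ : ∀ {n Bs} → All (IsLarge (n ∷ [])) Bs → map top Bs ⊆ concat Bs
tops-⊆ []       = []
tops-⊆ (l ∷ ls) = ++⁺ (from∈ (top∈ l)) (tops-⊆ ls)

-- Cutting into blocks, and majority colours.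

cut : ∀ z {e} V → IsLarge (replicate z e ++ []) V →
      ∃ λ Cs → concat Cs ⊆ V × length Cs ≡ z × All (IsLarge (e ∷ [])) Cs
cut zero        V l = [] , minimum V , refl , []
cut (suc z) {e} V l
  with C , W , refl , lC , lW ← split (e ∷ []) V l
  with Cs , Cs⊆ , len , lCs ← cut z W lW
  = C ∷ Cs , ++⁺ ⊆-refl Cs⊆ , cong suc len , lC ∷ lCs

length-classes : ∀ {A : Set} (f : A → Fin 2) xs →
  length xs ≡ length (filter (λ x → f x Fin.≟ zero) xs) + length (filter (λ x → f x Fin.≟ suc zero) xs)
length-classes f []       = refl
length-classes f (x ∷ xs) with f x
... | zero     = cong suc (length-classes f xs)
... | suc zero = trans (cong suc (length-classes f xs)) (sym (+-suc _ _))

majority : ∀ {A : Set} {a} (f : A → Fin 2) xs → 2 * a ≤ length xs →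
           ∃ λ c → a ≤ length (filter (λ x → f x Fin.≟ c) xs)
majority {a = a} f xs 2a≤ with ≤-total a (length (filter (λ x → f x Fin.≟ zero) xs))
... | inj₁ le = zero , le
... | inj₂ ge = suc zero , +-cancelˡ-≤ a _ _ (begin
    a + a                ≡⟨ cong (a +_) (+-identityʳ a) ⟨
    2 * a                ≤⟨ 2a≤ ⟩
    length xs            ≡⟨ length-classes f xs ⟩
    _ + length ones      ≤⟨ +-monoˡ-≤ (length ones) ge ⟩
    a + length ones      ∎)
  where
  open ≤-Reasoning
  ones = filter (λ x → f x Fin.≟ suc zero) xs

-- Refining blocks to an ω-grouping.

module _ (p : ℕ → ℕ → Fin 2) where

  record Uniform (A B : List ℕ) : Set where
    constructor uniform
    field uniform⁻ : ∀ {x y y′} → x ∈ˡ A → y ∈ˡ B → y′ ∈ˡ B → p x y ≡ p x y′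

  record Homogeneous (A B : List ℕ) : Set where
    constructor homogeneous
    field homogeneous⁻ : ∀ {x x′ y y′} → x ∈ˡ A → x′ ∈ˡ A → y ∈ˡ B → y′ ∈ˡ B → p x y ≡ p x′ y′

  open Uniform
  open Homogeneous

  Homogeneous-⊆ : ∀ {A A′ B B′} → A′ ⊆ A → B′ ⊆ B → Homogeneous A B → Homogeneous A′ B′
  Homogeneous-⊆ s t h = homogeneous λ x∈ x′∈ y∈ y′∈ →
    homogeneous⁻ h (Any-resp-⊆ s x∈) (Any-resp-⊆ s x′∈) (Any-resp-⊆ t y∈) (Any-resp-⊆ t y′∈)

  -- If B is uniform over x, this is the colour from x to all of B; the default `0` is reached only
  -- for an empty B.
  colourOf : ℕ → List ℕ → Fin 2
  colourOf x B = p x (headOr 0 B)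

  -- `prev` holds all earlier elements, including those of the blocks already shrunk. They give
  -- 2^|prev| colour vectors, a number below every element of the next block by sparsity, so each
  -- block loses one exponent.
  refine-uniform : ∀ n prev Cs → Sparse (prev ++ concat Cs) → All (IsLarge (suc n ∷ [])) Cs →
    ∃ λ Ds → Sublist _⊆_ Ds Cs × length Ds ≡ length Cs × All (IsLarge (n ∷ [])) Ds ×
             All (Uniform prev) Ds × AllPairs Uniform Ds
  refine-uniform n prev []       sp []        = [] , [] , refl , [] , [] , []
  refine-uniform n prev (C ∷ Cs) sp (lC ∷ lCs)
    with D , D⊆C , lD , same ← monochromatic* n (λ i y → p (lookup prev i) y) C
           (Sparse-resp-⊆ (++⁺ˡ prev (++⁺ʳ (concat Cs) ⊆-refl)) sp)
           (2^length< prev (Sparse-resp-⊆ (++⁺ (⊆-refl {x = prev}) (++⁺ʳ (concat Cs) ⊆-refl)) sp)) lC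
    with Ds , Ds⊑Cs , len , lDs , uni , unis ← refine-uniform n (prev ++ D) Cs
           (Sparse-resp-⊆ (⊆-trans (⊆-reflexive (++-assoc prev D (concat Cs)))
             (++⁺ (⊆-refl {x = prev}) (++⁺ D⊆C ⊆-refl))) sp) lCs
    = D ∷ Ds , D⊆C ∷ Ds⊑Cs , cong suc len , lD ∷ lDs
    , uniform (λ x∈ y∈ y′∈ → subst (λ w → p w _ ≡ p w _) (sym (lookup-index x∈)) (same y∈ y′∈ (Any.index x∈)))
      ∷ All.map (λ u → uniform λ x∈ → uniform⁻ u (∈-++⁺ˡ x∈)) uni
    , All.map (λ u → uniform λ x∈ → uniform⁻ u (∈-++⁺ʳ prev x∈)) uni ∷ unis

  -- One majority vote per element of U accounts for the factor 2^|U|. The first surviving block is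
  -- the reference for the common colour.
  agreeing-blocks : ∀ U {m} Ds → 2 ^ length U * m ≤ length Ds →
    ∃ λ Es → Es ⊆ Ds × length Es ≡ m ×
             (∀ {x E} → x ∈ˡ U → E ∈ˡ Es → colourOf x E ≡ colourOf x (headOr [] Es))
  agreeing-blocks [] {m} Ds le =
    take m Ds , take-⊆ m Ds , trans (length-take m Ds) (m≤n⇒m⊓n≡m (≤-trans (≤-reflexive (sym (*-identityˡ m))) le)) , λ ()
  agreeing-blocks (x ∷ U) {m} Ds le
    with c , half ← majority (colourOf x) Ds (≤-trans (≤-reflexive (sym (*-assoc 2 (2 ^ length U) m))) le)
    with Es , Es⊆ , len , agree ← agreeing-blocks U (filter (λ D → colourOf x D Fin.≟ c) Ds) half
    = Es , ⊆-trans Es⊆ (filter-⊆ _ Ds) , len , λ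
      { (here refl) E∈ → trans (All.lookup all E∈) (sym (All.lookup all (headOr∈ E∈)))
      ; (there x∈)  E∈ → agree x∈ E∈ }
    where all = All-resp-⊆ Es⊆ (All.all-filter (λ D → colourOf x D Fin.≟ c) Ds)

  -- By uniformity the colours from x reduce to one bit per later block, so at most 2^m vectors
  -- occur. They are read off the unshrunk blocks `Es`; homogeneity then passes to their subsets.
  refine-homogeneous : ∀ n Es {m} → length Es ≤ m → Sparse (concat Es) → All (2 ^ m <_) (concat Es) →
    All (IsLarge (suc n ∷ [])) Es → AllPairs Uniform Es →
    ∃ λ Fs → Sublist _⊆_ Fs Es × length Fs ≡ length Es × All (IsLarge (n ∷ [])) Fs × AllPairs Homogeneous Fs
  refine-homogeneous n []       _   sp 2^m< []         []           = [] , [] , refl , [] , []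
  refine-homogeneous n (E ∷ Es) len sp 2^m< (lE ∷ lEs) (uni ∷ unis)
    with Fs , Fs⊑Es , len′ , lFs , homs ← refine-homogeneous n Es (<⇒≤ len)
           (Sparse-resp-⊆ (++⁺ˡ E ⊆-refl) sp) (All.++⁻ʳ E 2^m<) lEs unis
    with F , F⊆E , lF , same ← monochromatic* n (λ j x → colourOf x (lookup Es j)) E
           (Sparse-resp-⊆ (++⁺ʳ (concat Es) ⊆-refl) sp)
           (All.map (≤-<-trans (^-monoʳ-≤ 2 (<⇒≤ len))) (All.++⁻ˡ E 2^m<)) lE
    = F ∷ Fs , F⊆E ∷ Fs⊑Es , cong suc len′ , lF ∷ lFs
    , All-Sublist (Homogeneous-⊆ ⊆-refl) Fs⊑Es
        (All.tabulate λ {E′} E′∈ → homogeneous λ {x} {x′} {y} {y′} x∈ x′∈ y∈ y′∈ → begin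
          p x y            ≡⟨ uniform⁻ (All.lookup uni E′∈) (Any-resp-⊆ F⊆E x∈) y∈ (headOr∈ y∈) ⟩
          colourOf x E′    ≡⟨ subst (λ B → colourOf x B ≡ colourOf x′ B) (sym (lookup-index E′∈)) (same x∈ x′∈ (Any.index E′∈)) ⟩
          colourOf x′ E′   ≡⟨ uniform⁻ (All.lookup uni E′∈) (Any-resp-⊆ F⊆E x′∈) y′∈ (headOr∈ y′∈) ⟨
          p x′ y′          ∎)
      ∷ homs
    where open ≡-Reasoning

  -- V is cut into z blocks. They start at exponent `2 + n` and lose one for uniformity and one for
  -- homogeneity; U loses one. Exactly `top U` blocks are kept, so every element of B is at most
  -- their number.
  ω-grouping-split : ∀ n U {z V} → Sparse (U ++ z ∷ V) →
    IsLarge (1 + n ∷ []) U → IsLarge (replicate z (2 + n) ++ []) V →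
    ∃ λ B → ∃ λ Bs → concat (B ∷ Bs) ⊆ U ++ V × All (IsLarge (n ∷ [])) (B ∷ Bs) ×
                     AllPairs Homogeneous (B ∷ Bs) × All (_≤ length Bs) B
  ω-grouping-split n U {z} {V} sp lU lV
    with Cs , Cs⊆V , |Cs|≡z , lCs ← cut z V lV
    with Ds , Ds⊑Cs , |Ds|≡|Cs| , lDs , uniU , unis ← refine-uniform (1 + n) U Cs
           (Sparse-resp-⊆ (++⁺ (⊆-refl {x = U}) (z ∷ʳ Cs⊆V)) sp) lCs
    with Es , Es⊆Ds , |Es|≡m , agree ← agreeing-blocks U {top U} Ds 
           (≤-trans (2^length*top≤ U sp lU) (≤-reflexive (sym (trans |Ds|≡|Cs| |Cs|≡z))))
    with concatEs⊆V ← ⊆-trans (concat⁺ (Sublist-trans-⊆ Es⊆Ds Ds⊑Cs)) Cs⊆V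
    -- The reference block decides the colour from x to every kept block, so two colours suffice on
    -- U.
    with B , B⊆U , lB , same ← monochromatic n (λ x → colourOf x (headOr [] Es)) U
           (Sparse-resp-⊆ (++⁺ʳ (z ∷ V) ⊆-refl) sp)
           (All.++⁻ˡ U (≥3 sp)) lU
    with Fs , Fs⊑Es , |Fs|≡|Es| , lFs , homs ← refine-homogeneous n Es (≤-reflexive |Es|≡m)
           (Sparse-resp-⊆ (++⁺ˡ U (z ∷ʳ concatEs⊆V)) sp)
           (All.tabulate λ v∈ → ≤-<-trans (^-monoˡ-≤ (top U) (s≤s (s≤s z≤n)))
             (AllPairs-++⁻ U (gap sp) (top∈ lU) (there (Any-resp-⊆ concatEs⊆V v∈))))
           (All-resp-⊆ Es⊆Ds lDs) (AllPairs-resp-⊆ Es⊆Ds unis)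
    = B , Fs , ++⁺ B⊆U (⊆-trans (concat⁺ Fs⊑Es) concatEs⊆V) , lB ∷ lFs
    , All-Sublist (Homogeneous-⊆ ⊆-refl) Fs⊑Es (All.tabulate λ {E} E∈ →
        let uni = uniform⁻ (All.lookup uniU (Any-resp-⊆ Es⊆Ds E∈)) in
        homogeneous λ {x} {x′} {y} {y′} x∈ x′∈ y∈ y′∈ → begin
          p x y                       ≡⟨ uni (Any-resp-⊆ B⊆U x∈) y∈ (headOr∈ y∈) ⟩
          colourOf x E                ≡⟨ agree (Any-resp-⊆ B⊆U x∈) E∈ ⟩
          colourOf x (headOr [] Es)   ≡⟨ same x∈ x′∈ ⟩
          colourOf x′ (headOr [] Es)  ≡⟨ agree (Any-resp-⊆ B⊆U x′∈) E∈ ⟨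
          colourOf x′ E               ≡⟨ uni (Any-resp-⊆ B⊆U x′∈) y′∈ (headOr∈ y′∈) ⟨
          p x′ y′                     ∎)
      ∷ homs
    , All.tabulate λ w∈ → ≤-trans (≤top U (Any-resp-⊆ B⊆U w∈)) (≤-reflexive (sym (trans |Fs|≡|Es| |Es|≡m)))
    where open ≡-Reasoning

  ω-grouping : ∀ n X → Sparse X → IsLarge (4 + n ∷ []) X →
    ∃ λ B → ∃ λ Bs → concat (B ∷ Bs) ⊆ X × All (IsLarge (n ∷ [])) (B ∷ Bs) ×
                     AllPairs Homogeneous (B ∷ Bs) × All (_≤ length Bs) B
  ω-grouping n (x ∷ X) sp@(sparse (3≤x ∷ _) _) (next l)
    -- Stepping at x ≥ 3 leaves at least two copies of ω^(3+n). The first yields U; the second,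
    -- stepped at z, leaves z copies of ω^(2+n) for V.
    with U , z ∷ V , refl , lU , next lV ← split (3 + n ∷ []) X
           (replicate-mono {b = 2} (AllPairs.tail (increasing′ sp)) (≤-trans (s≤s (s≤s z≤n)) 3≤x) l)
    with spUV ← Sparse-resp-⊆ (x ∷ʳ ⊆-refl) sp
    with spU ← Sparse-resp-⊆ (++⁺ʳ (z ∷ V) (⊆-refl {x = U})) spUV
    with B , Bs , Bs⊆UV , rest ← ω-grouping-split n U spUV (lower spU (lower spU lU)) lV
    = B , Bs , ⊆-trans Bs⊆UV (x ∷ʳ ++⁺ (⊆-refl {x = U}) (z ∷ʳ ⊆-refl)) , rest

  -- Concatenating groupings and induction on k.

  record ListGrouping (n k : ℕ) (X : List ℕ) : Set where
    field
      blocks       : List (List ℕ)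
      blocks⊆X     : concat blocks ⊆ X
      blocks-large : All (IsLarge (n ∷ [])) blocks
      blocks-hom   : AllPairs Homogeneous blocks
      tops-large   : IsLarge (k ∷ []) (map top blocks)

  open ListGrouping

  concatBlocks : ∀ {n k Bs} → All (ListGrouping n k) Bs → List (List ℕ)
  concatBlocks []       = []
  concatBlocks (g ∷ gs) = blocks g ++ concatBlocks gs

  concatBlocks-⊆ : ∀ {n k Bs} (gs : All (ListGrouping n k) Bs) → concat (concatBlocks gs) ⊆ concat Bs
  concatBlocks-⊆ []       = []
  concatBlocks-⊆ (g ∷ gs) = ⊆-trans (⊆-reflexive (sym (concat-++ (blocks g) (concatBlocks gs))))
                              (++⁺ (blocks⊆X g) (concatBlocks-⊆ gs))

  concatBlocks-large : ∀ {n k Bs} (gs : All (ListGrouping n k) Bs) → All (IsLarge (n ∷ [])) (concatBlocks gs)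
  concatBlocks-large []       = []
  concatBlocks-large (g ∷ gs) = All.++⁺ (blocks-large g) (concatBlocks-large gs)

  block⊆ : ∀ {n k B G} (g : ListGrouping n k B) → G ∈ˡ blocks g → G ⊆ B
  block⊆ g G∈ = ⊆-trans (∈⇒⊆concat G∈) (blocks⊆X g)

  concatBlocks-hom₁ : ∀ {n k A G Bs} (gs : All (ListGrouping n k) Bs) → G ⊆ A →
                      All (Homogeneous A) Bs → All (Homogeneous G) (concatBlocks gs)
  concatBlocks-hom₁ []       s []       = []
  concatBlocks-hom₁ (g ∷ gs) s (h ∷ hs) = All.++⁺
    (All.tabulate λ G∈ → Homogeneous-⊆ s (block⊆ g G∈) h) (concatBlocks-hom₁ gs s hs)

  concatBlocks-hom : ∀ {n k Bs} (gs : All (ListGrouping n k) Bs) → AllPairs Homogeneous Bs →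
                     AllPairs Homogeneous (concatBlocks gs)
  concatBlocks-hom []       []       = []
  concatBlocks-hom (g ∷ gs) (h ∷ hs) = AllPairs.++⁺ (blocks-hom g) (concatBlocks-hom gs hs)
    (All.tabulate λ G∈ → concatBlocks-hom₁ gs (block⊆ g G∈) h)

  -- Each grouping contributes an ω^k-large run of maxima, and the runs follow one another, so their
  -- sum ω^k·|Bs| is reached.
  concatBlocks-tops : ∀ {n k Bs} (gs : All (ListGrouping n k) Bs) → Increasing (concat Bs) →
                      IsLarge (replicate (length Bs) k ++ []) (map top (concatBlocks gs))
  concatBlocks-tops []       inc = done
  concatBlocks-tops {k = k} {B ∷ Bs} (g ∷ gs) inc =
    subst (IsLarge _) (sym tops≡) (join (map top (blocks g))
      (subst Increasing tops≡
        (AllPairs-resp-⊆ (⊆-trans (tops-⊆ (concatBlocks-large (g ∷ gs))) (concatBlocks-⊆ (g ∷ gs))) inc))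
      (tops-large g) (concatBlocks-tops gs (AllPairs-resp-⊆ (++⁺ˡ B ⊆-refl) inc)))
    where tops≡ = map-++ top (blocks g) (concatBlocks gs)

  -- The first block g of the grouping of B has top g ≤ |Bs|, so after top g there remain at
  -- least top g sets that are ω^k-large.
  concat-tops-large : ∀ {n k B Bs} (gs : All (ListGrouping n k) (B ∷ Bs)) → Increasing (concat (B ∷ Bs)) →
                      All (_≤ length Bs) B → IsLarge (suc k ∷ []) (map top (concatBlocks gs))
  concat-tops-large {k = k} gs@(g ∷ _) inc B≤
    with blocks g | All.tabulate (block⊆ g) | blocks-large g | tops-large g
       | AllPairs-resp-⊆ (⊆-trans (tops-⊆ (concatBlocks-large gs)) (concatBlocks-⊆ gs)) inc
       | concatBlocks-tops gs inc
  -- A grouping without blocks would make ω^k large on the empty list.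
  ... | []    | _       | _      | () | _    | _
  ... | G ∷ _ | G⊆B ∷ _ | lG ∷ _ | _  | inc′ | l =
    next (replicate-mono (AllPairs.tail inc′) (All.lookup B≤ (Any-resp-⊆ G⊆B (top∈ lG)))
      (drop-step _ (AllPairs.tail inc′) l))

  grouping : ∀ n k X → Sparse X → IsLarge (6 * k + n ∷ []) X → ListGrouping n k X
  grouping n zero    X sp l = record
    { blocks       = X ∷ []
    ; blocks⊆X     = ⊆-reflexive (++-identityʳ X)
    ; blocks-large = l ∷ []
    ; blocks-hom   = [] ∷ []
    ; tops-large   = next done
    }
  grouping n (suc k) X sp l
    -- The exponent is `6 + (6 * k + n)`; two uses of `lower` bring it to the form `4 + (6 * k + n)`
    -- taken by `ω-grouping`, whose members then have the exponent of the induction hypothesis.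
    with B , Bs , Bs⊆X , ls , homs , B≤ ← ω-grouping (6 * k + n) X sp
      (lower sp (lower sp (subst (λ e → IsLarge (e ∷ []) X) (cong (_+ n) (*-suc 6 k)) l)))
    = record
    { blocks       = concatBlocks gs
    ; blocks⊆X     = ⊆-trans (concatBlocks-⊆ gs) Bs⊆X
    ; blocks-large = concatBlocks-large gs
    ; blocks-hom   = concatBlocks-hom gs homs
    ; tops-large   = concat-tops-large gs (increasing′ (Sparse-resp-⊆ Bs⊆X sp)) B≤
    }
    where
    gs : All (ListGrouping n k) (B ∷ Bs)
    gs = All.tabulate λ {B′} B′∈ → grouping n k B′
      (Sparse-resp-⊆ (⊆-trans (∈⇒⊆concat B′∈) Bs⊆X) sp) (All.lookup ls B′∈)

-- Transfer to finite sets and colourings of pairs.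

IsLarge⇒Large : ∀ α .(c : CNF α) {X} → IsLarge α X → foldl _[_] (ord α c) X ≡ 𝟘
IsLarge⇒Large []  c done             = refl
IsLarge⇒Large α   c (next {x = x} l) = IsLarge⇒Large (step α x) (step-cnf α x c) l

Large⇒IsLarge : ∀ α .(c : CNF α) X → foldl _[_] (ord α c) X ≡ 𝟘 → IsLarge α X
Large⇒IsLarge α c []      eq with refl ← cong exponents eq = done
Large⇒IsLarge α c (x ∷ X) eq = next (Large⇒IsLarge (step α x) (step-cnf α x c) X eq)

toSparse : (X : FinSet) → ExpSparse (_∈ X) → Sparse (elements X)
toSparse (finSet X inc) (≥3 , gap) = sparse (All.tabulate ≥3) (go X inc gap)
  where
  go : ∀ X → Increasing X → (∀ {x y} → x ∈ˡ X → y ∈ˡ X → x < y → 4 ^ x < y) → AllPairs (λ x y → 4 ^ x < y) X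
  go []      _           gap = []
  go (x ∷ X) (x<X ∷ inc) gap =
    All.tabulate (λ y∈ → gap (here refl) (there y∈) (All.lookup x<X y∈))
    ∷ go X inc (λ x∈ y∈ → gap (there x∈) (there y∈))

-- Pairs outside [X]² get the junk colour zero.
extend : (X : FinSet) → Colouring (_∈ X) → ℕ → ℕ → Fin 2
extend X P x y with _∈?_ _≟_ x (elements X) | _∈?_ _≟_ y (elements X) | x <? y
... | yes x∈ | yes y∈ | yes x<y = P (pair x y x∈ y∈ x<y)
... | _      | _      | _       = zero

-- When all three tests succeed `refl` suffices, because the proofs stored in `pair` are irrelevant.
extend-≡ : ∀ X (P : Colouring (_∈ X)) {x y} (x∈ : x ∈ X) (y∈ : y ∈ X) (x<y : x < y) →
           P (pair x y x∈ y∈ x<y) ≡ extend X P x y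
extend-≡ X P {x} {y} x∈ y∈ x<y with _∈?_ _≟_ x (elements X) | _∈?_ _≟_ y (elements X) | x <? y
... | yes _  | yes _  | yes _  = refl
... | no x∉  | _      | _      = ⊥-elim (x∉ x∈)
... | yes _  | no y∉  | _      = ⊥-elim (y∉ y∈)
... | yes _  | yes _  | no x≮y = ⊥-elim (x≮y x<y)

-- Largeness excludes the empty list, since ω^n is not zero.
toFinSet⁺ : ∀ {n} B → IsLarge (n ∷ []) B → Increasing B → FinSet⁺
toFinSet⁺ (x ∷ B) _ inc = finSet⁺ (x ∷ B) inc

forget-toFinSet⁺ : ∀ {n} B (l : IsLarge (n ∷ []) B) inc → elements (forget (toFinSet⁺ B l inc)) ≡ B
forget-toFinSet⁺ (x ∷ B) l inc = refl

max-toFinSet⁺ : ∀ {n} B (l : IsLarge (n ∷ []) B) inc → max (toFinSet⁺ B l inc) ≡ top B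
max-toFinSet⁺ (x ∷ B) l inc = refl

max<min : ∀ F G → (∀ {x y} → x ∈⁺ F → y ∈⁺ G → x < y) → max F < min G
max<min (finSet⁺ (x ∷ xs) _) (finSet⁺ (y ∷ ys) _) F<G =
  Extrema.v<min⁺ (below (here refl)) (All.tabulate (λ y∈ → below (there y∈)))
  where
  below : ∀ {w} → w ∈ˡ y ∷ ys → Extrema.max x xs < w
  below w∈ = Extrema.max<v⁺ (F<G (here refl) w∈) (All.tabulate (λ x∈ → F<G (there x∈) w∈))

toGrouping : ∀ {n k} X (P : Colouring (_∈ X)) → ListGrouping (extend X P) n k (elements X) →
             Grouping (ω^ n) (ω^ k) (_∈ X) P
toGrouping {n} {k} X P g = record
  { ℓ            = length blocks
  ; F            = F
  ; F⊆X          = λ {i} x∈ → F⊆X i x∈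
  ; separated    = sep
  ; F-large      = λ i → IsLarge⇒Large (n ∷ []) ([] ∷ []) (subst (IsLarge (n ∷ [])) (sym (F≡ i)) (large i))
  ; maxima-large = IsLarge⇒Large (k ∷ []) ([] ∷ []) (subst (IsLarge (k ∷ [])) (sym maxima≡) tops-large)
  ; homogeneous  = λ {i} {j} i<j x∈ x′∈ y∈ y′∈ →
      trans (extend-≡ X P (F⊆X i x∈) (F⊆X j y∈) (separated⇒< F sep i<j x∈ y∈))
        (trans (homogeneous⁻ (AllPairs-lookup blocks-hom i<j) (∈F i x∈) (∈F i x′∈) (∈F j y∈) (∈F j y′∈))
          (sym (extend-≡ X P (F⊆X i x′∈) (F⊆X j y′∈) (separated⇒< F sep i<j x′∈ y′∈))))
  }
  where
  open ListGrouping g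
  open Homogeneous

  inc : Increasing (concat blocks)
  inc = AllPairs-resp-⊆ blocks⊆X (increasing X)

  block⊆concat : ∀ i → lookup blocks i ⊆ concat blocks
  block⊆concat i = ∈⇒⊆concat {Bs = blocks} (∈-lookup i)

  large : ∀ i → IsLarge (n ∷ []) (lookup blocks i)
  large i = All.lookup blocks-large (∈-lookup i)

  F : Fin (length blocks) → FinSet⁺
  F i = toFinSet⁺ (lookup blocks i) (large i) (AllPairs-resp-⊆ (block⊆concat i) inc)

  F≡ : ∀ i → elements (forget (F i)) ≡ lookup blocks i
  F≡ i = forget-toFinSet⁺ (lookup blocks i) (large i) (AllPairs-resp-⊆ (block⊆concat i) inc)

  ∈F : ∀ i {x} → x ∈⁺ F i → x ∈ˡ lookup blocks i
  ∈F i {x} = subst (x ∈ˡ_) (F≡ i)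

  F⊆X : ∀ i {x} → x ∈⁺ F i → x ∈ X
  F⊆X i x∈ = Any-resp-⊆ (⊆-trans (block⊆concat i) blocks⊆X) (∈F i x∈)

  sep : Separated F
  sep {i} {j} i<j = max<min (F i) (F j) λ x∈ y∈ →
    AllPairs-lookup (AllPairs-concat⁻ blocks inc) i<j (∈F i x∈) (∈F j y∈)

  maxima≡ : tabulate (λ i → max (F i)) ≡ map top blocks
  maxima≡ = begin
    tabulate (λ i → max (F i))           ≡⟨ tabulate-cong (λ i → max-toFinSet⁺ (lookup blocks i) (large i) _) ⟩
    tabulate (λ i → top (lookup blocks i)) ≡⟨ map-tabulate (lookup blocks) top ⟨
    map top (tabulate (lookup blocks))   ≡⟨ cong (map top) (tabulate-lookup blocks) ⟩
    map top blocks                       ∎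
    where open ≡-Reasoning

theorem2p4 : (n k : ℕ) (X : FinSet) → Large (ω^ (n + 6 * k)) X → ExpSparse (_∈ X) → AdmitsGrouping (ω^ n) (ω^ k) (_∈ X)
theorem2p4 n k X large sp P = toGrouping X P
  (grouping (extend X P) n k (elements X) (toSparse X sp)
    (subst (λ e → IsLarge (e ∷ []) (elements X)) (+-comm n (6 * k))
      (Large⇒IsLarge (n + 6 * k ∷ []) ([] ∷ []) (elements X) large)))
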